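{- There is an absolute constant $\gamma_0>0$ such that for every positive integer $n$ and every $\alpha < \gamma_0 n$, every graph on $n$ vertices with at least $\frac{n^2}{8} + \frac{3}{2}\alpha n$ edges contains a copy of $K_4$ or an independent set of size greater than $\alpha$. -}

module Defs where

open import Data.Nat using (ℕ; zero; suc; _+_; _*_)
open import Data.Bool using (Bool; true; false; if_then_else_)
open import Data.Fin using (Fin; toℕ; _<?_)
open import Data.Fin.Subset using (Subset; _∈_; ∣_∣)
open import Data.List using (List; map; allFin)
open import Data.Nat.ListAction using (sum)
open import Data.Integer using (+_)
open import Data.Rational using (ℚ; _/_; _<_; _≤_; _+_; _*_)
open import Data.Product using (Σ; _×_)
open import Relation.Nullary using (¬_; does)
open import Relation.Binary.PropositionalEquality using (_≡_)
open import Function.Definitions using (Injective)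

record Graph (n : ℕ) : Set where
  field
    adj   : Fin n → Fin n → Bool
    sym   : ∀ i j → adj i j ≡ adj j i
    irrefl : ∀ i → adj i i ≡ false
open Graph public

edgeCount : ∀ {n} → Graph n → ℕ
edgeCount {n} G =
  sum (map (λ i → sum (map (λ j →
         if does (i <? j) then (if adj G i j then 1 else 0) else 0)
       (allFin n))) (allFin n))

HasK4 : ∀ {n} → Graph n → Set
HasK4 {n} G = Σ (Fin 4 → Fin n) λ f →
  Injective _≡_ _≡_ f × (∀ a b → ¬ (a ≡ b) → adj G (f a) (f b) ≡ true)

Independent : ∀ {n} → Graph n → Subset n → Set
Independent G S = ∀ i j → i ∈ S → j ∈ S → adj G i j ≡ false

ℕ→ℚ : ℕ → ℚ
ℕ→ℚ k = + k / 1

{-# OPTIONS --safe #-}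
module Submission where

-- Let G be K₄-free with all independent sets of size at most a. Adjacent vertices have at most a common
-- neighbours, so for any S the vertices adjacent to more than (|S| + a) / 2 vertices of S are independent: every
-- pair of large sets has edge density at most about 1/2. Deleting vertices of degree below 0.249 n reduces to the case of
-- minimum degree 0.249 n, since every deletion increases the surplus of edges over 499 n² / 4000.
--
-- In that case there is a set R of almost n / 2 vertices in which every vertex has at most n / 100 neighbours.
-- Start with U = V and C = ∅ and let R be the vertices outside C with at least |U| / 1000 neighbours in U; by
-- density, |R| is almost n / 2. If z has more than n / 100 neighbours in R, replace U by U ∩ N(z) and C by
-- C ∪ (N(z) ∩ R): vertices of U keep few neighbours in C, by the codegree bound. As C grows by n / 100 each time,
-- this stops.
--
-- Let X be the vertices with at least 3n / 100 neighbours in R. By density each of them has almost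
-- n / 4 neighbours in R, and every other vertex has over n / 5 neighbours outside R. The neighbourhoods of a triangle
-- are almost disjoint, so neither X nor its complement contains a triangle, hence the degrees inside the two parts are
-- at most a, and there are at most n² / 8 + a n edges in total.

open import Defs renaming (sym to adj-sym)
open import Data.Bool using (Bool; true; false; _∧_; _∨_; not; if_then_else_)
import Data.Bool.Properties as Bool
open import Data.Fin using (Fin; zero; suc; punchIn; punchOut)
import Data.Fin as Fin
import Data.Fin.Properties as Fin
open import Data.Fin.Subset using (Subset; ∣_∣; _∈_; ⁅_⁆)
open import Data.Fin.Subset.Properties using (anySubset?; _∈?_; x∈⁅y⁆⇒x≡y; ∣⁅x⁆∣≡1)
open import Data.Integer as ℤ using (+_; -[1+_])
import Data.Integer.Properties as ℤ
open import Data.List using ([]; _∷_)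
import Data.List as List
import Data.List.Properties as List
open import Data.Nat
open import Data.Nat.Coprimality using (Coprime)
open import Data.Nat.DivMod using (m/n*n≤m; /-mono-≤; m*n/n≡m)
import Data.Nat.ListAction as ℕ
open import Data.Nat.Properties
open import Data.Nat.Tactic.RingSolver using (solve)
open import Data.Product using (Σ; _×_; _,_; proj₁; proj₂)
open import Data.Rational as ℚ using (ℚ; 0ℚ; mkℚ; toℚᵘ; fromℚᵘ)
import Data.Rational.Properties as ℚ
open import Data.Rational.Unnormalised as ℚᵘ using (mkℚᵘ; _≃_; *<*)
import Data.Rational.Unnormalised.Properties as ℚᵘ
open import Data.Sum using (_⊎_; inj₁; inj₂)
import Data.Vec as Vec
import Data.Vec.Properties as Vec
open import Data.Vec.Functional using (insertAt)
open import Data.Vec.Functional.Properties using (insertAt-lookup; insertAt-punchIn)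
open import Function using (_∘_; id)
open import Relation.Binary.Definitions using (tri<; tri≈; tri>)
open import Relation.Binary.PropositionalEquality
  using (_≡_; refl; sym; cong; cong₂; subst; subst₂; trans; module ≡-Reasoning)
open import Relation.Nullary using (Dec; yes; no; does; ¬_; contradiction)
open import Relation.Nullary.Decidable using (_×-dec_; _→-dec_)
import Algebra.Properties.Semiring.Sum +-*-semiring as Sum

-- Certified linear arithmetic

infixl 6 _⊕_
infixr 7 _⊙_

_⊕_ : ∀ {a b c d} → a ≤ b → c ≤ d → a + c ≤ b + d
_⊕_ = +-mono-≤

_⊙_ : ∀ k {a b} → a ≤ b → k * a ≤ k * b
_⊙_ = *-monoʳ-≤

-- Linear arithmetic by certificate: l ≤ r is a combination of the hypotheses (built with _⊕_ and _⊙_), and the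
-- equation is left to the ring solver.
certify : ∀ {l r x y} c .{{_ : NonZero c}} s → l ≤ r → c * x + r + s ≡ c * y + l → x ≤ y
certify {l} {r} {x} {y} c s l≤r eq = *-cancelˡ-≤ c (+-cancelʳ-≤ r (c * x) (c * y) (begin
  c * x + r      ≤⟨ m≤m+n _ s ⟩
  c * x + r + s  ≡⟨ eq ⟩
  c * y + l      ≤⟨ +-monoʳ-≤ (c * y) l≤r ⟩
  c * y + r      ∎))
  where open ≤-Reasoning

-- The slack is the square of the difference `t`; splitting on which number is larger keeps `t` a
-- natural.
4pq≤[p+q]² : ∀ p q → 4 * (p * q) ≤ (p + q) * (p + q)
4pq≤[p+q]² p q with ≤-total p q
... | inj₁ p≤q with t , refl ← m≤n⇒∃[o]m+o≡n p≤q = certify 1 (t * t) (z≤n {0}) (solve (p ∷ t ∷ []))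
... | inj₂ q≤p with t , refl ← m≤n⇒∃[o]m+o≡n q≤p = certify 1 (t * t) (z≤n {0}) (solve (q ∷ t ∷ []))

-- Vertex sets and edge counts

VSet : ℕ → Set
VSet n = Fin n → Bool

private variable n : ℕ

-- Opacity lets the summands be inferred from equations between sums.
opaque
  sum : (Fin n → ℕ) → ℕ
  sum = Sum.sum

  sum-cong : {f g : Fin n → ℕ} → (∀ i → f i ≡ g i) → sum f ≡ sum g
  sum-cong = Sum.sum-cong-≗

  sum-+ : (f g : Fin n → ℕ) → sum (λ i → f i + g i) ≡ sum f + sum g
  sum-+ = Sum.∑-distrib-+

  sum-comm : {m : ℕ} (f : Fin m → Fin n → ℕ) → sum (λ i → sum (f i)) ≡ sum (λ j → sum (λ i → f i j))
  sum-comm = Sum.∑-comm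

  *-sum : ∀ k (f : Fin n → ℕ) → k * sum f ≡ sum (λ i → k * f i)
  *-sum = Sum.*-distribˡ-sum

  sum-* : ∀ (f : Fin n → ℕ) k → sum f * k ≡ sum (λ i → f i * k)
  sum-* f k = Sum.*-distribʳ-sum k f

  sum-punchIn : ∀ (v : Fin (suc n)) f → sum f ≡ f v + sum (f ∘ punchIn v)
  sum-punchIn v f = Sum.sum-remove f

  sum-const : ∀ k → sum {n} (λ _ → k) ≡ n * k
  sum-const {zero}  k = refl
  sum-const {suc n} k = cong (_+_ k) (sum-const {n} k)

  sum-mono : {f g : Fin n → ℕ} → (∀ i → f i ≤ g i) → sum f ≤ sum g
  sum-mono {zero}  f≤g = z≤n
  sum-mono {suc n} f≤g = f≤g zero ⊕ sum-mono (f≤g ∘ suc)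

⟦_⟧ : Bool → ℕ
⟦ true  ⟧ = 1
⟦ false ⟧ = 0

infixr 6 _∩_

_∩_ : VSet n → VSet n → VSet n
(P ∩ Q) i = P i ∧ Q i

∁ : VSet n → VSet n
∁ P i = not (P i)

count : VSet n → ℕ
count P = sum (⟦_⟧ ∘ P)

∑∈ : VSet n → (Fin n → ℕ) → ℕ
∑∈ Q f = sum (λ x → ⟦ Q x ⟧ * f x)

does-true : ∀ {P : Set} (P? : Dec P) → does P? ≡ true → P
does-true (yes p) _ = p

does-false : ∀ {P : Set} (P? : Dec P) → does P? ≡ false → ¬ P
does-false (no ¬p) _ = ¬p

∧-true : ∀ {p q} → p ∧ q ≡ true → p ≡ true × q ≡ true
∧-true {true} {true} _ = refl , refl

∧-intro : ∀ {p q} → p ≡ true → q ≡ true → p ∧ q ≡ true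
∧-intro refl refl = refl

not-true : ∀ {p} → not p ≡ true → p ≡ false
not-true {false} _ = refl

count-full : count {n} (λ _ → true) ≡ n
count-full {n} = trans (sum-const 1) (*-identityʳ n)

count-mono : {P Q : VSet n} → (∀ i → P i ≡ true → Q i ≡ true) → count P ≤ count Q
count-mono {P = P} {Q} P⊆Q = sum-mono λ i → pointwise (P i) (Q i) (P⊆Q i)
  where
  pointwise : ∀ p q → (p ≡ true → q ≡ true) → ⟦ p ⟧ ≤ ⟦ q ⟧
  pointwise true  q p⇒q rewrite p⇒q refl = ≤-refl
  pointwise false q p⇒q = z≤n

∑∈-split : (P Q : VSet n) (f : Fin n → ℕ) → ∑∈ P f ≡ ∑∈ (P ∩ Q) f + ∑∈ (P ∩ ∁ Q) f
∑∈-split P Q f = trans (sum-cong λ i → pointwise (P i) (Q i) (f i)) (sum-+ _ _)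
  where
  pointwise : ∀ p q k → ⟦ p ⟧ * k ≡ ⟦ p ∧ q ⟧ * k + ⟦ p ∧ not q ⟧ * k
  pointwise true  true  k = sym (+-identityʳ _)
  pointwise true  false k = refl
  pointwise false q     k = refl

count-split : (P Q : VSet n) → count P ≡ count (P ∩ Q) + count (P ∩ ∁ Q)
count-split P Q = trans (sum-cong λ i → pointwise (P i) (Q i)) (sum-+ _ _)
  where
  pointwise : ∀ p q → ⟦ p ⟧ ≡ ⟦ p ∧ q ⟧ + ⟦ p ∧ not q ⟧
  pointwise true  true  = refl
  pointwise true  false = refl
  pointwise false q     = refl

count-≤ : (P : VSet n) → count P ≤ n
count-≤ P = subst (count P ≤_) count-full (count-mono λ _ _ → refl)

count-∁ : (P : VSet n) → count P + count (∁ P) ≡ n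
count-∁ P = trans (sym (count-split (λ _ → true) P)) count-full

∑∈-mono : (Q : VSet n) {f g : Fin n → ℕ} → (∀ x → Q x ≡ true → f x ≤ g x) → ∑∈ Q f ≤ ∑∈ Q g
∑∈-mono Q {f} {g} f≤g = sum-mono λ x → pointwise (Q x) (f≤g x)
  where
  pointwise : ∀ b {j k} → (b ≡ true → j ≤ k) → ⟦ b ⟧ * j ≤ ⟦ b ⟧ * k
  pointwise true  h = 1 ⊙ h refl
  pointwise false h = z≤n

∑∈-const : (Q : VSet n) (k : ℕ) → ∑∈ Q (λ _ → k) ≡ count Q * k
∑∈-const Q k = sym (sum-* _ k)

∑∈-+ : (Q : VSet n) (f g : Fin n → ℕ) → ∑∈ Q (λ x → f x + g x) ≡ ∑∈ Q f + ∑∈ Q g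
∑∈-+ Q f g = trans (sum-cong λ x → *-distribˡ-+ ⟦ Q x ⟧ (f x) (g x)) (sum-+ _ _)

∑∈-* : (Q : VSet n) (k : ℕ) (f : Fin n → ℕ) → ∑∈ Q (λ x → k * f x) ≡ k * ∑∈ Q f
∑∈-* Q k f = trans (sum-cong λ x → solve-swap ⟦ Q x ⟧ k (f x)) (sym (*-sum k _))
  where
  solve-swap : ∀ a b c → a * (b * c) ≡ b * (a * c)
  solve-swap a b c = solve (a ∷ b ∷ c ∷ [])

∑∈-≤-sum : (Q : VSet n) (f : Fin n → ℕ) → ∑∈ Q f ≤ sum f
∑∈-≤-sum Q f = sum-mono λ x → pointwise (Q x) (f x)
  where
  pointwise : ∀ b k → ⟦ b ⟧ * k ≤ k
  pointwise true  k = ≤-reflexive (*-identityˡ k)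
  pointwise false k = z≤n

∑∈-bound : ∀ (Q : VSet n) m c k f → (∀ x → Q x ≡ true → m ≤ c + k * f x) →
  count Q * m ≤ count Q * c + k * ∑∈ Q f
∑∈-bound Q m c k f h = begin
  count Q * m                              ≡⟨ ∑∈-const Q m ⟨
  ∑∈ Q (λ _ → m)                           ≤⟨ ∑∈-mono Q h ⟩
  ∑∈ Q (λ x → c + k * f x)                 ≡⟨ ∑∈-+ Q _ _ ⟩
  ∑∈ Q (λ _ → c) + ∑∈ Q (λ x → k * f x)    ≡⟨ cong₂ _+_ (∑∈-const Q c) (∑∈-* Q k f) ⟩
  count Q * c + k * ∑∈ Q f                 ∎
  where open ≤-Reasoning

-- Codegree and edge density

IsIndependent : Graph n → VSet n → Set
IsIndependent G P = ∀ i j → P i ≡ true → P j ≡ true → adj G i j ≡ false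

-- In a K₄-free graph the common neighbourhood of two adjacent vertices is independent, so both fields hold
-- when no independent set has more than a vertices; unlike K₄-freeness they are all the proof needs.
record Bounded (a : ℕ) (G : Graph n) : Set where
  field
    codegree     : ∀ u v → adj G u v ≡ true → count (adj G u ∩ adj G v) ≤ a
    independence : ∀ P → IsIndependent G P → count P ≤ a

module Edges {n} (G : Graph n) where

  deg : Fin n → VSet n → ℕ
  deg x S = count (adj G x ∩ S)

  -- Ordered pairs are counted, so `edges Q Q` is twice the number of edges inside `Q`.
  edges : VSet n → VSet n → ℕ
  edges Q S = ∑∈ Q λ x → deg x S

  deg-split : ∀ x S T → deg x S ≡ deg x (S ∩ T) + deg x (S ∩ ∁ T)
  deg-split x S T = trans (count-split (adj G x ∩ S) T)
    (cong₂ _+_ (sum-cong λ y → cong ⟦_⟧ (Bool.∧-assoc (adj G x y) (S y) (T y)))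
               (sum-cong λ y → cong ⟦_⟧ (Bool.∧-assoc (adj G x y) (S y) (not (T y)))))

  deg-≤ : ∀ x S → deg x S ≤ count S
  deg-≤ x S = count-mono λ y → proj₂ ∘ ∧-true

  edges-comm : ∀ Q S → edges Q S ≡ edges S Q
  edges-comm Q S = trans (sum-cong λ x → *-sum ⟦ Q x ⟧ _)
    (trans (sum-comm λ x y → ⟦ Q x ⟧ * ⟦ adj G x y ∧ S y ⟧)
    (trans (sum-cong λ y → sum-cong λ x → swap x y)
           (sym (sum-cong λ y → *-sum ⟦ S y ⟧ _))))
    where
    pointwise : ∀ q e s → ⟦ q ⟧ * ⟦ e ∧ s ⟧ ≡ ⟦ s ⟧ * ⟦ e ∧ q ⟧
    pointwise true  true  true  = refl
    pointwise true  true  false = refl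
    pointwise true  false true  = refl
    pointwise true  false false = refl
    pointwise false true  true  = refl
    pointwise false true  false = refl
    pointwise false false true  = refl
    pointwise false false false = refl
    swap : ∀ x y → ⟦ Q x ⟧ * ⟦ adj G x y ∧ S y ⟧ ≡ ⟦ S y ⟧ * ⟦ adj G y x ∧ Q x ⟧
    swap x y rewrite adj-sym G y x = pointwise (Q x) (adj G x y) (S y)

  edges-upper : ∀ Q S c k → (∀ x → Q x ≡ true → c * deg x S ≤ k) → c * edges Q S ≤ count Q * k
  edges-upper Q S c k h = begin
    c * edges Q S               ≡⟨ ∑∈-* Q c _ ⟨
    ∑∈ Q (λ x → c * deg x S)    ≤⟨ ∑∈-mono Q h ⟩
    ∑∈ Q (λ _ → k)              ≡⟨ ∑∈-const Q k ⟩
    count Q * k                 ∎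
    where open ≤-Reasoning

module Density {n} (G : Graph n) {a} (bd : Bounded a G) where

  open Bounded bd
  open Edges G

  codegree-in : ∀ S u v → adj G u v ≡ true → count (adj G u ∩ adj G v ∩ S) ≤ a
  codegree-in S u v uv = ≤-trans
    (count-mono λ y uvy → let uy , vSy = ∧-true {adj G u y} uvy in ∧-intro uy (proj₁ (∧-true vSy)))
    (codegree u v uv)

  -- Inclusion-exclusion: the two neighbourhoods overlap in at most `a` vertices.
  deg-edge : ∀ S u v → adj G u v ≡ true → deg u S + deg v S ≤ count S + a
  deg-edge S u v uv = begin
    deg u S + deg v S
      ≡⟨ sum-+ _ _ ⟨
    sum (λ y → ⟦ adj G u y ∧ S y ⟧ + ⟦ adj G v y ∧ S y ⟧)
      ≤⟨ sum-mono (λ y → pointwise (adj G u y) (adj G v y) (S y)) ⟩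
    sum (λ y → ⟦ S y ⟧ + ⟦ adj G u y ∧ adj G v y ⟧)
      ≡⟨ sum-+ _ _ ⟩
    count S + count (adj G u ∩ adj G v)
      ≤⟨ +-monoʳ-≤ (count S) (codegree u v uv) ⟩
    count S + a ∎
    where
    open ≤-Reasoning
    pointwise : ∀ p q s → ⟦ p ∧ s ⟧ + ⟦ q ∧ s ⟧ ≤ ⟦ s ⟧ + ⟦ p ∧ q ⟧
    pointwise true  true  true  = ≤-refl
    pointwise true  true  false = z≤n
    pointwise true  false true  = ≤-refl
    pointwise true  false false = ≤-refl
    pointwise false true  true  = ≤-refl
    pointwise false true  false = ≤-refl
    pointwise false false true  = z≤n
    pointwise false false false = ≤-refl

  -- A vertex adjacent to k of the three corners is counted k times, and k is at most 1 + k (k - 1)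
  -- / 2; each of the three pairwise overlaps has at most `a` vertices.
  deg-triangle : ∀ S x y z → adj G x y ≡ true → adj G x z ≡ true → adj G y z ≡ true →
                 deg x S + deg y S + deg z S ≤ count S + 3 * a
  deg-triangle S x y z xy xz yz = begin
    deg x S + deg y S + deg z S
      ≡⟨ trans (sum-+ _ _) (cong (_+ deg z S) (sum-+ _ _)) ⟨
    sum (λ w → ⟦ adj G x w ∧ S w ⟧ + ⟦ adj G y w ∧ S w ⟧ + ⟦ adj G z w ∧ S w ⟧)
      ≤⟨ sum-mono (λ w → pointwise (adj G x w) (adj G y w) (adj G z w) (S w)) ⟩
    sum (λ w → ⟦ S w ⟧ + (⟦ adj G x w ∧ adj G y w ⟧ + (⟦ adj G x w ∧ adj G z w ⟧ + ⟦ adj G y w ∧ adj G z w ⟧)))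
      ≡⟨ trans (sum-+ _ _) (cong (_+_ (count S)) (trans (sum-+ _ _) (cong (_+_ (count (adj G x ∩ adj G y))) (sum-+ _ _)))) ⟩
    count S + (count (adj G x ∩ adj G y) + (count (adj G x ∩ adj G z) + count (adj G y ∩ adj G z)))
      ≤⟨ +-monoʳ-≤ (count S) (codegree x y xy ⊕ (codegree x z xz ⊕ ≤-trans (codegree y z yz) (m≤m+n a 0))) ⟩
    count S + 3 * a ∎
    where
    open ≤-Reasoning
    pointwise : ∀ p q r s → ⟦ p ∧ s ⟧ + ⟦ q ∧ s ⟧ + ⟦ r ∧ s ⟧ ≤ ⟦ s ⟧ + (⟦ p ∧ q ⟧ + (⟦ p ∧ r ⟧ + ⟦ q ∧ r ⟧))
    pointwise true  true  true  true  = s≤s (s≤s (s≤s z≤n))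
    pointwise true  true  false true  = ≤-refl
    pointwise true  false true  true  = ≤-refl
    pointwise true  false false true  = ≤-refl
    pointwise false true  true  true  = ≤-refl
    pointwise false true  false true  = ≤-refl
    pointwise false false true  true  = ≤-refl
    pointwise false false false true  = z≤n
    pointwise true  true  r     false = ≤-trans (≤-reflexive (cong ⟦_⟧ (Bool.∧-zeroʳ r))) z≤n
    pointwise true  false r     false = ≤-trans (≤-reflexive (cong ⟦_⟧ (Bool.∧-zeroʳ r))) z≤n
    pointwise false true  r     false = ≤-trans (≤-reflexive (cong ⟦_⟧ (Bool.∧-zeroʳ r))) z≤n
    pointwise false false r     false = ≤-trans (≤-reflexive (cong ⟦_⟧ (Bool.∧-zeroʳ r))) z≤n

  -- By `deg-edge` two adjacent vertices cannot both be `heavy`, so at most `a` vertices are. A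
  -- light vertex contributes at most `count S + a` to the doubled count, a heavy one at most
  -- `count S` beyond that.
  edges-density : ∀ Q S → 2 * edges Q S ≤ count Q * (count S + a) + a * count S
  edges-density Q S = begin
    2 * edges Q S                                                  ≡⟨ ∑∈-* Q 2 _ ⟨
    ∑∈ Q (λ x → 2 * deg x S)                                       ≤⟨ ∑∈-mono Q (λ x _ → bound x) ⟩
    ∑∈ Q (λ x → (count S + a) + ⟦ heavy x ⟧ * count S)             ≡⟨ ∑∈-+ Q _ _ ⟩
    ∑∈ Q (λ _ → count S + a) + ∑∈ Q (λ x → ⟦ heavy x ⟧ * count S)  ≤⟨ +-mono-≤ (≤-reflexive (∑∈-const Q _)) (∑∈-≤-sum Q _) ⟩
    count Q * (count S + a) + ∑∈ heavy (λ _ → count S)             ≡⟨ cong (_+_ (count Q * (count S + a))) (∑∈-const heavy _) ⟩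
    count Q * (count S + a) + count heavy * count S                ≤⟨ +-monoʳ-≤ _ (*-monoˡ-≤ (count S) heavy-small) ⟩
    count Q * (count S + a) + a * count S                          ∎
    where
    open ≤-Reasoning
    heavy? : ∀ x → Dec (count S + a < 2 * deg x S)
    heavy? x = count S + a <? 2 * deg x S
    heavy : VSet n
    heavy x = does (heavy? x)
    too-many : ∀ p q s → s < 2 * p → s < 2 * q → ¬ p + q ≤ s
    too-many p q s s<2p s<2q p+q≤s = n≮n (2 * s) (certify 1 1 (s<2p ⊕ s<2q ⊕ 2 ⊙ p+q≤s) (solve (p ∷ q ∷ s ∷ [])))
    heavy-independent : IsIndependent G heavy
    heavy-independent u v hu hv with adj G u v in uv
    ... | false = refl
    ... | true  = contradiction (deg-edge S u v uv)
      (too-many (deg u S) (deg v S) (count S + a) (does-true (heavy? u) hu) (does-true (heavy? v) hv))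
    heavy-small : count heavy ≤ a
    heavy-small = independence heavy heavy-independent
    bound : ∀ x → 2 * deg x S ≤ (count S + a) + ⟦ heavy x ⟧ * count S
    bound x = pointwise (deg x S) (count S) (heavy? x) (deg-≤ x S)
      where
      pointwise : ∀ d s (h? : Dec (s + a < 2 * d)) → d ≤ s → 2 * d ≤ s + a + ⟦ does h? ⟧ * s
      pointwise d s (no light) _   = ≤-trans (≮⇒≥ light) (m≤m+n _ _)
      pointwise d s (yes _)    d≤s = certify 1 a (2 ⊙ d≤s) (solve (d ∷ s ∷ a ∷ []))

-- A sparse set of almost half of the vertices

-- `B` dominates every power `1000 ^ k` by which `U` can have shrunk, so `a-small` keeps `1000 * a`
-- below `count U` at every stage.
module MinDegree {n} (G : Graph n) {a} (bd : Bounded a G) (n>0 : 0 < n)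
  (min-degree : ∀ x → 249 * n ≤ 1000 * count (adj G x))
  (B : ℕ) (B-big : ∀ k → k ≤ 101 → 1000 ^ k ≤ B) (a-small : 1000 * a * B ≤ n) where

  open Edges G
  open Density G bd

  a-tiny : 1000000 * a ≤ n
  a-tiny = ≤-trans (≤-trans (≤-reflexive (reassoc a)) ((1000 * a) ⊙ B-big 1 (s≤s z≤n))) a-small
    where
    reassoc : ∀ a → 1000000 * a ≡ 1000 * a * 1000
    reassoc a = solve (a ∷ [])

  -- A relaxed notion: seeing more than a thousandth of `U` suffices. The same fraction bounds the
  -- loss when `U` is cut down to the neighbourhood of such a vertex.
  common-neighbours : VSet n → VSet n
  common-neighbours U w = does (count U <? 1000 * deg w U)

  -- Count edges from `U`: every degree is at least 0.249 n, at most `k * a` of it goes to `C`, and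
  -- the vertices outside `C` and `R` receive at most n |U| / 1000 edges in total. So about 0.248 n
  -- |U| edges run to `R`, and `edges-density` forces |R| to be almost twice 0.248 n.
  common-large : ∀ U C k → k ≤ 101 → (∀ x → U x ≡ true → deg x C ≤ k * a) → n ≤ 1000 ^ k * count U →
    490 * n ≤ 1000 * count (∁ C ∩ common-neighbours U)
  common-large U C k k≤101 U-C U-large =
    arith n (count U) a (count R) (k * a) (edges U R) (edges U R̄)
      U>0 U-edges
      R̄-light (≤-trans (edges-density U R) (+-monoʳ-≤ _ (*-monoʳ-≤ a (count-≤ R))))
      aM (*-monoˡ-≤ a k≤101) a-tiny
    where
    H R R̄ : VSet n
    H = common-neighbours U
    R = ∁ C ∩ H
    R̄ = ∁ C ∩ ∁ H
    instance
      1000^k≢0 : NonZero (1000 ^ k)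
      1000^k≢0 = m^n≢0 1000 k
    U>0 : 0 < count U
    U>0 with count U
    ... | suc _ = s≤s z≤n
    ... | zero  = contradiction (≤-trans n>0 (≤-trans U-large (≤-reflexive (*-zeroʳ (1000 ^ k))))) λ ()
    aM : 1000 * a ≤ count U
    aM = *-cancelˡ-≤ (1000 ^ k) (begin
      1000 ^ k * (1000 * a)  ≤⟨ *-monoˡ-≤ (1000 * a) (B-big k k≤101) ⟩
      B * (1000 * a)         ≡⟨ *-comm B (1000 * a) ⟩
      1000 * a * B           ≤⟨ a-small ⟩
      n                      ≤⟨ U-large ⟩
      1000 ^ k * count U     ∎)
      where open ≤-Reasoning
    lower : ∀ x → U x ≡ true → 249 * n ≤ 1000 * (k * a) + 1000 * (deg x R + deg x R̄)
    lower x Ux = pointwise (count (adj G x)) (deg x C) (deg x (∁ C)) (deg x R) (deg x R̄) (k * a) n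
      (min-degree x) (count-split (adj G x) C) (deg-split x (∁ C) H) (U-C x Ux)
      where
      pointwise : ∀ d c c̄ r r̄ ka n → 249 * n ≤ 1000 * d → d ≡ c + c̄ → c̄ ≡ r + r̄ → c ≤ ka →
        249 * n ≤ 1000 * ka + 1000 * (r + r̄)
      pointwise d c c̄ r r̄ ka n h refl refl c≤ka =
        certify 1 0 (h ⊕ 1000 ⊙ c≤ka) (solve (c ∷ r ∷ r̄ ∷ ka ∷ n ∷ []))
    U-edges : count U * (249 * n) ≤ count U * (1000 * (k * a)) + 1000 * (edges U R + edges U R̄)
    U-edges = subst (λ e → count U * (249 * n) ≤ count U * (1000 * (k * a)) + 1000 * e)
      (∑∈-+ U (λ x → deg x R) (λ x → deg x R̄))
      (∑∈-bound U (249 * n) (1000 * (k * a)) 1000 (λ x → deg x R + deg x R̄) lower)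
    R̄-light : 1000 * edges U R̄ ≤ n * count U
    R̄-light = begin
      1000 * edges U R̄     ≡⟨ cong (1000 *_) (edges-comm U R̄) ⟩
      1000 * edges R̄ U     ≤⟨ edges-upper R̄ U 1000 (count U) (λ w R̄w →
                                ≮⇒≥ (does-false (count U <? 1000 * deg w U) (not-true (proj₂ (∧-true {not (C w)} R̄w))))) ⟩
      count R̄ * count U    ≤⟨ *-monoˡ-≤ (count U) (count-≤ R̄) ⟩
      n * count U          ∎
      where open ≤-Reasoning
    arith : ∀ n u a r ka e ē → 0 < u → u * (249 * n) ≤ u * (1000 * ka) + 1000 * (e + ē) →
      1000 * ē ≤ n * u → 2 * e ≤ u * (r + a) + a * n → 1000 * a ≤ u → ka ≤ 101 * a → 1000000 * a ≤ n →
      490 * n ≤ 1000 * r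
    arith n u@(suc _) a r ka e ē _ h₁ h₂ h₃ h₄ h₅ h₆ =
      certify 1 (4 * n + 797000 * a) (2000 ⊙ h₅ ⊕ h₆ ⊕ cancelled) (solve (n ∷ a ∷ r ∷ ka ∷ []))
      where
      -- Here 498 is twice 249. Of the `3 * n`, two parts come from the edges to `R̄` and one from
      -- the density error `a * n`, using `1000 * a ≤ u`.
      cancelled : 498 * n ≤ 2000 * ka + 1000 * r + 1000 * a + 3 * n
      cancelled = *-cancelˡ-≤ u (combine n u a r ka e ē h₁ h₂ h₃ h₄)
        where
        combine : ∀ n u a r ka e ē → u * (249 * n) ≤ u * (1000 * ka) + 1000 * (e + ē) →
          1000 * ē ≤ n * u → 2 * e ≤ u * (r + a) + a * n → 1000 * a ≤ u →
          u * (498 * n) ≤ u * (2000 * ka + 1000 * r + 1000 * a + 3 * n)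
        combine n u a r ka e ē h₁ h₂ h₃ h₄ =
          certify 1 0 (2 ⊙ h₁ ⊕ 2 ⊙ h₂ ⊕ 1000 ⊙ h₃ ⊕ n ⊙ h₄) (solve (n ∷ u ∷ a ∷ r ∷ ka ∷ e ∷ ē ∷ []))

  SparseSet : Set
  SparseSet = Σ (VSet n) λ R → 490 * n ≤ 1000 * count R × (∀ z → R z ≡ true → 100 * deg z R ≤ n)

  record Partial (k : ℕ) : Set where
    field
      U C     : VSet n
      U-C     : ∀ x → U x ≡ true → deg x C ≤ k * a
      C-large : k * n ≤ 100 * count C
      U-large : n ≤ 1000 ^ k * count U

    R : VSet n
    R = ∁ C ∩ common-neighbours U

    Dense : Fin n → Set
    Dense z = R z ≡ true × n < 100 * deg z R

  -- Every vertex of the new `U` is adjacent to `z`, so by the codegree bound it has at most `a`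
  -- neighbours in the piece added to `C`. That piece lies in `R`, which avoids `C`, so the sizes
  -- add; and `z`, being in `R`, sees more than a thousandth of `U`.
  grow : ∀ {k} (s : Partial k) z → Partial.Dense s z → Partial (suc k)
  grow {k} s z (Rz , dense) = record { U = U′ ; C = C′ ; U-C = U′-C′ ; C-large = C′-large ; U-large = U′-large }
    where
    open Partial s
    U′ C′ : VSet n
    U′ = adj G z ∩ U
    C′ x = C x ∨ (adj G z x ∧ R x)
    C′-count : count C′ ≡ count C + deg z R
    C′-count = trans (sum-cong λ x → pointwise (C x) (adj G z x) (common-neighbours U x)) (sum-+ _ _)
      where
      pointwise : ∀ c e h → ⟦ c ∨ (e ∧ not c ∧ h) ⟧ ≡ ⟦ c ⟧ + ⟦ e ∧ not c ∧ h ⟧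
      pointwise true  true  h = refl
      pointwise true  false h = refl
      pointwise false e     h = refl
    deg-C′ : ∀ x → deg x C′ ≤ deg x C + count (adj G x ∩ adj G z ∩ R)
    deg-C′ x = ≤-trans (sum-mono λ y → pointwise (adj G x y) (C y) (adj G z y ∧ R y)) (≤-reflexive (sum-+ _ _))
      where
      pointwise : ∀ e c r → ⟦ e ∧ (c ∨ r) ⟧ ≤ ⟦ e ∧ c ⟧ + ⟦ e ∧ r ⟧
      pointwise true  true  r = s≤s z≤n
      pointwise true  false r = ≤-refl
      pointwise false c     r = z≤n
    U′-C′ : ∀ x → U′ x ≡ true → deg x C′ ≤ suc k * a
    U′-C′ x U′x with zx , Ux ← ∧-true U′x = begin
      deg x C′                                    ≤⟨ deg-C′ x ⟩
      deg x C + count (adj G x ∩ adj G z ∩ R)     ≤⟨ U-C x Ux ⊕ codegree-in R x z (trans (adj-sym G x z) zx) ⟩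
      k * a + a                                   ≡⟨ +-comm (k * a) a ⟩
      suc k * a                                   ∎
      where open ≤-Reasoning
    C′-large : suc k * n ≤ 100 * count C′
    C′-large = subst (λ c → suc k * n ≤ 100 * c) (sym C′-count)
      (≤-trans (<⇒≤ dense ⊕ C-large) (≤-reflexive (expand (count C) (deg z R))))
      where
      expand : ∀ c d → 100 * d + 100 * c ≡ 100 * (c + d)
      expand c d = solve (c ∷ d ∷ [])
    z-common : count U < 1000 * deg z U
    z-common = does-true (count U <? 1000 * deg z U) (proj₂ (∧-true {not (C z)} Rz))
    U′-large : n ≤ 1000 ^ suc k * count U′
    U′-large = begin
      n                                ≤⟨ U-large ⟩
      1000 ^ k * count U               ≤⟨ *-monoʳ-≤ (1000 ^ k) (<⇒≤ z-common) ⟩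
      1000 ^ k * (1000 * count U′)     ≡⟨ *-assoc (1000 ^ k) 1000 (count U′) ⟨
      1000 ^ k * 1000 * count U′       ≡⟨ cong (_* count U′) (*-comm (1000 ^ k) 1000) ⟩
      1000 ^ suc k * count U′          ∎
      where open ≤-Reasoning

  stop : ∀ {k} → k ≤ 101 → (s : Partial k) → ¬ (Σ (Fin n) (Partial.Dense s)) → SparseSet
  stop {k} k≤101 s none = R , common-large U C k k≤101 U-C U-large , λ z Rz → ≮⇒≥ λ dense → none (z , Rz , dense)
    where open Partial s

  -- Stage 100 could still fill the vertex set exactly; stage 101 would give `C` more than `n`
  -- vertices.
  full : ¬ Partial 101
  full s = <⇒≱ n>0 (overfull n (count C) C-large (count-≤ C))
    where
    open Partial s
    overfull : ∀ n c → 101 * n ≤ 100 * c → c ≤ n → n ≤ 0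
    overfull n c h c≤n = certify 1 0 (h ⊕ 100 ⊙ c≤n) (solve (n ∷ c ∷ []))

  mutual
    -- `fuel` is the number of steps left before the impossible stage 101.
    sparse-set-from : ∀ fuel {k} → fuel + k ≡ 101 → Partial k → SparseSet
    sparse-set-from zero       eq s = contradiction (subst Partial eq s) full
    sparse-set-from (suc fuel) eq s = decide fuel eq s
      (Fin.any? λ z → (Partial.R s z Bool.≟ true) ×-dec (n <? 100 * deg z (Partial.R s)))

    decide : ∀ fuel {k} → suc fuel + k ≡ 101 → (s : Partial k) → Dec (Σ (Fin n) (Partial.Dense s)) → SparseSet
    decide fuel     eq s (no none)     = stop (m+n≤o⇒n≤o (suc fuel) (≤-reflexive eq)) s none
    decide fuel {k} eq s (yes (z , d)) = sparse-set-from fuel (trans (+-suc fuel k) eq) (grow s z d)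

  sparse-set : SparseSet
  sparse-set = sparse-set-from 101 refl record
    { U       = λ _ → true
    ; C       = λ _ → false
    ; U-C     = λ x _ → ≤-trans (deg-≤ x (λ _ → false)) (≤-reflexive (trans (sum-const {n} 0) (*-zeroʳ n)))
    ; C-large = z≤n
    ; U-large = ≤-reflexive (sym (trans (+-identityʳ _) count-full))
    }

-- The two parts

module Partition {n} (G : Graph n) {a} (bd : Bounded a G) (n>0 : 0 < n) (a-tiny : 1000000 * a ≤ n)
  (min-degree : ∀ x → 249 * n ≤ 1000 * count (adj G x))
  (R : VSet n) (R-large : 490 * n ≤ 1000 * count R) (R-sparse : ∀ z → R z ≡ true → 100 * Edges.deg G z R ≤ n) where

  open Edges G
  open Density G bd

  -- The threshold leaves room on both sides: 0.03 n is large compared with `a`, and a vertex below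
  -- it keeps 0.219 n neighbours outside `R`.
  X? : ∀ x → Dec (3 * n ≤ 100 * deg x R)
  X? x = 3 * n ≤? 100 * deg x R

  X : VSet n
  X x = does (X? x)

  -- Each neighbour of `x` in `R` has at most n / 100 neighbours in `R` and at most `a` in common
  -- with `x`, so about 0.239 n of its neighbours lie in `J`, the vertices outside `R` not adjacent
  -- to `x`. By density `J` has almost 0.478 n vertices, which leaves little room for neighbours of
  -- `x` outside `R`.
  deg-R-large : ∀ x → X x ≡ true → 1000 * count R ≤ 1000 * deg x R + 285 * n
  deg-R-large x Xx = arith n (count R) (count (∁ R)) (count I) (count J) (count P) (count (adj G x))
      (min-degree x) (count-split (adj G x) R) R̄-split (count-∁ R) J-large
    where
    P I J : VSet n
    P = adj G x ∩ R
    I = adj G x ∩ ∁ R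
    J = ∁ R ∩ ∁ (adj G x)
    P-large : 3 * n ≤ 100 * count P
    P-large = does-true (X? x) Xx
    R̄-split : count (∁ R) ≡ count I + count J
    R̄-split = trans (count-split (∁ R) (adj G x))
      (cong (_+ count J) (sum-cong λ y → cong ⟦_⟧ (Bool.∧-comm (not (R y)) (adj G x y))))
    lower : ∀ p → P p ≡ true → 239 * n ≤ 1000 * a + 1000 * deg p J
    lower p Pp = let xp , Rp = ∧-true Pp in
      pointwise n a (count (adj G p)) (deg p R) (deg p (∁ R)) (deg p (∁ R ∩ adj G x)) (deg p J)
        (min-degree p) (count-split (adj G p) R) (deg-split p (∁ R) (adj G x)) (R-sparse p Rp)
        (≤-trans (count-mono λ y → shuffle (adj G p y) (R y) (adj G x y)) (codegree-in (∁ R) p x (trans (adj-sym G p x) xp)))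
      where
      shuffle : ∀ e r f → e ∧ not r ∧ f ≡ true → e ∧ f ∧ not r ≡ true
      shuffle true false true _ = refl
      pointwise : ∀ n a d r r̄ i j → 249 * n ≤ 1000 * d → d ≡ r + r̄ → r̄ ≡ i + j → 100 * r ≤ n → i ≤ a →
        239 * n ≤ 1000 * a + 1000 * j
      pointwise n a d r r̄ i j h₁ refl refl h₂ h₃ =
        certify 1 0 (h₁ ⊕ 10 ⊙ h₂ ⊕ 1000 ⊙ h₃) (solve (n ∷ a ∷ r ∷ i ∷ j ∷ []))
    J-large : 7 * n ≤ 15 * count J
    J-large = arith n a (count P) (count J) (edges P J) n>0
      P-large (∑∈-bound P (239 * n) (1000 * a) 1000 (λ p → deg p J) lower)
      (≤-trans (edges-density P J) (+-monoʳ-≤ _ (*-monoʳ-≤ a (count-≤ J)))) a-tiny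
      where
      arith : ∀ n a p j e → 0 < n → 3 * n ≤ 100 * p → p * (239 * n) ≤ p * (1000 * a) + 1000 * e →
        2 * e ≤ p * (j + a) + a * n → 1000000 * a ≤ n → 7 * n ≤ 15 * j
      arith n a zero j e n>0 h₁ _ _ _ = contradiction (≤-trans (m≤m+n n _) h₁) (<⇒≱ n>0)
      arith n a p@(suc _) j e _ h₁ h₂ h₃ h₄ =
        certify 100 (16 * n + 945500 * a) (h₄ ⊕ cancelled) (solve (n ∷ a ∷ j ∷ []))
        where
        -- The density error is absorbed through `3 * n ≤ 100 * p`: 1500 a n is at most 50000 a p,
        -- and 54500 is 50000 + 3000 + 1500.
        combine : ∀ n a p j e → 3 * n ≤ 100 * p → p * (239 * n) ≤ p * (1000 * a) + 1000 * e →
          2 * e ≤ p * (j + a) + a * n → p * (717 * n) ≤ p * (54500 * a + 1500 * j)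
        combine n a p j e h₁ h₂ h₃ =
          certify 1 0 ((500 * a) ⊙ h₁ ⊕ 3 ⊙ h₂ ⊕ 1500 ⊙ h₃) (solve (n ∷ a ∷ p ∷ j ∷ e ∷ []))
        cancelled : 717 * n ≤ 54500 * a + 1500 * j
        cancelled = *-cancelˡ-≤ p (combine n a p j e h₁ h₂ h₃)
    arith : ∀ n r r̄ i j p d → 249 * n ≤ 1000 * d → d ≡ p + i → r̄ ≡ i + j → r + r̄ ≡ n → 7 * n ≤ 15 * j →
      1000 * r ≤ 1000 * p + 285 * n
    arith n r r̄ i j p d h₁ refl refl refl h₂ = certify 3 (2 * (r + (i + j))) (3 ⊙ h₁ ⊕ 200 ⊙ h₂) (solve (r ∷ i ∷ j ∷ p ∷ []))

  -- Three neighbourhoods in `R`, each missing at most 0.285 n of it and overlapping pairwise in at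
  -- most `a`, require 2 |R| ≤ 0.855 n + 3 a, against |R| ≥ 0.49 n.
  X-triangle-free : ∀ x y z → X x ≡ true → X y ≡ true → X z ≡ true →
    adj G x y ≡ true → adj G x z ≡ true → ¬ adj G y z ≡ true
  X-triangle-free x y z Xx Xy Xz xy xz yz = arith n a (count R) (deg x R) (deg y R) (deg z R) n>0
    (deg-R-large x Xx) (deg-R-large y Xy) (deg-R-large z Xz) R-large (deg-triangle R x y z xy xz yz) a-tiny
    where
    arith : ∀ n a r p q s → 0 < n → 1000 * r ≤ 1000 * p + 285 * n → 1000 * r ≤ 1000 * q + 285 * n →
      1000 * r ≤ 1000 * s + 285 * n → 490 * n ≤ 1000 * r → p + q + s ≤ r + 3 * a → ¬ 1000000 * a ≤ n
    arith n a r p q s n>0 h₁ h₂ h₃ h₄ h₅ h₆ = <⇒≱ n>0 (certify 1 (123 * n + 997000 * a)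
      (h₁ ⊕ h₂ ⊕ h₃ ⊕ 2 ⊙ h₄ ⊕ 1000 ⊙ h₅ ⊕ h₆) (solve (n ∷ a ∷ r ∷ p ∷ q ∷ s ∷ [])))

  deg-R̄-large : ∀ y → ∁ X y ≡ true → 219 * n ≤ 1000 * deg y (∁ R)
  deg-R̄-large y X̄y = arith n (count (adj G y)) (deg y R) (deg y (∁ R)) (min-degree y) (count-split (adj G y) R)
    (<⇒≤ (≰⇒> (does-false (X? y) (not-true X̄y))))
    where
    arith : ∀ n d r r̄ → 249 * n ≤ 1000 * d → d ≡ r + r̄ → 100 * r ≤ 3 * n → 219 * n ≤ 1000 * r̄
    arith n d r r̄ h₁ refl h₂ = certify 1 0 (h₁ ⊕ 10 ⊙ h₂) (solve (n ∷ r ∷ r̄ ∷ []))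

  -- Three almost disjoint neighbourhoods of 0.219 n vertices need about 0.657 n, but `∁ R` has at
  -- most 0.51 n.
  X̄-triangle-free : ∀ x y z → ∁ X x ≡ true → ∁ X y ≡ true → ∁ X z ≡ true →
    adj G x y ≡ true → adj G x z ≡ true → ¬ adj G y z ≡ true
  X̄-triangle-free x y z X̄x X̄y X̄z xy xz yz =
    arith n a (count R) (count (∁ R)) (deg x (∁ R)) (deg y (∁ R)) (deg z (∁ R)) n>0
      (deg-R̄-large x X̄x) (deg-R̄-large y X̄y) (deg-R̄-large z X̄z) R-large (count-∁ R)
      (deg-triangle (∁ R) x y z xy xz yz) a-tiny
    where
    arith : ∀ n a r r̄ p q s → 0 < n → 219 * n ≤ 1000 * p → 219 * n ≤ 1000 * q →
      219 * n ≤ 1000 * s → 490 * n ≤ 1000 * r → r + r̄ ≡ n → p + q + s ≤ r̄ + 3 * a → ¬ 1000000 * a ≤ n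
    arith n a r r̄ p q s n>0 h₁ h₂ h₃ h₄ refl h₅ h₆ = <⇒≱ n>0 (certify 1 (145 * (r + r̄) + 997000 * a)
      (h₁ ⊕ h₂ ⊕ h₃ ⊕ h₄ ⊕ 1000 ⊙ h₅ ⊕ h₆) (solve (a ∷ r ∷ r̄ ∷ p ∷ q ∷ s ∷ [])))

  triangle-free⇒edges-small : ∀ Q → (∀ x y z → Q x ≡ true → Q y ≡ true → Q z ≡ true →
    adj G x y ≡ true → adj G x z ≡ true → ¬ adj G y z ≡ true) → edges Q Q ≤ count Q * a
  triangle-free⇒edges-small Q triangle-free = ≤-trans (≤-reflexive (sym (*-identityˡ _)))
    (edges-upper Q Q 1 a λ x Qx → ≤-trans (≤-reflexive (*-identityˡ _)) (Bounded.independence bd (adj G x ∩ Q) (indep x Qx)))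
    where
    indep : ∀ x → Q x ≡ true → IsIndependent G (adj G x ∩ Q)
    indep x Qx y z xQy xQz = Bool.¬-not (triangle-free x y z Qx Qy Qz xy xz)
      where
      xy = proj₁ (∧-true {adj G x y} xQy)
      Qy = proj₂ (∧-true {adj G x y} xQy)
      xz = proj₁ (∧-true {adj G x z} xQz)
      Qz = proj₂ (∧-true {adj G x z} xQz)

  degree-sum-split : sum (λ x → count (adj G x)) ≡
    (edges X X + edges X (∁ X)) + (edges X (∁ X) + edges (∁ X) (∁ X))
  degree-sum-split = begin
    sum (λ x → count (adj G x))
      ≡⟨ sum-cong (λ x → sym (*-identityˡ _)) ⟩
    ∑∈ (λ _ → true) (λ x → count (adj G x))
      ≡⟨ ∑∈-split (λ _ → true) X _ ⟩
    ∑∈ X (λ x → count (adj G x)) + ∑∈ (∁ X) (λ x → count (adj G x))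
      ≡⟨ cong₂ _+_ (split X) (split (∁ X)) ⟩
    (edges X X + edges X (∁ X)) + (edges (∁ X) X + edges (∁ X) (∁ X))
      ≡⟨ cong (λ e → (edges X X + edges X (∁ X)) + (e + edges (∁ X) (∁ X))) (edges-comm (∁ X) X) ⟩
    (edges X X + edges X (∁ X)) + (edges X (∁ X) + edges (∁ X) (∁ X)) ∎
    where
    open ≡-Reasoning
    split : ∀ Q → ∑∈ Q (λ x → count (adj G x)) ≡ edges Q X + edges Q (∁ X)
    split Q = trans (sum-cong λ x → cong (⟦ Q x ⟧ *_) (count-split (adj G x) X)) (∑∈-+ Q _ _)

  -- The edges inside the two parts add at most a n to the degree sum. The edges across, counted
  -- twice, add at most p q + a n for part sizes p and q, and 4 p q ≤ n².
  degree-sum-bound : 4 * sum (λ x → count (adj G x)) ≤ n * n + 8 * (a * n)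
  degree-sum-bound = subst (λ t → 4 * t ≤ n * n + 8 * (a * n)) (sym degree-sum-split)
    (arith n a (count X) (count (∁ X)) (edges X X) (edges X (∁ X)) (edges (∁ X) (∁ X)) (count-∁ X)
      (triangle-free⇒edges-small X X-triangle-free) (triangle-free⇒edges-small (∁ X) X̄-triangle-free)
      (edges-density X (∁ X)))
    where
    arith : ∀ n a p q e f g → p + q ≡ n → e ≤ p * a → g ≤ q * a → 2 * f ≤ p * (q + a) + a * q →
      4 * ((e + f) + (f + g)) ≤ n * n + 8 * (a * n)
    arith n a p q e f g refl h₁ h₂ h₃ =
      certify 1 0 (4 ⊙ h₁ ⊕ 4 ⊙ h₂ ⊕ 4 ⊙ h₃ ⊕ 4pq≤[p+q]² p q) (solve (a ∷ p ∷ q ∷ e ∷ f ∷ g ∷ []))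

-- Reduction to large minimum degree

degree-sum : ∀ {n} → Graph n → ℕ
degree-sum G = sum λ x → count (adj G x)

degree-sum-bound : ∀ {n} (G : Graph n) {a} → Bounded a G → 0 < n → (∀ x → 249 * n ≤ 1000 * count (adj G x)) →
  ∀ B → (∀ k → k ≤ 101 → 1000 ^ k ≤ B) → 1000 * a * B ≤ n →
  4 * degree-sum G ≤ n * n + 8 * (a * n)
degree-sum-bound G bd n>0 min-degree B B-big a-small =
  let R , R-large , R-sparse = MinDegree.sparse-set G bd n>0 min-degree B B-big a-small in
  Partition.degree-sum-bound G bd n>0 (MinDegree.a-tiny G bd n>0 min-degree B B-big a-small)
    min-degree R R-large R-sparse

module Delete {m} (G : Graph (suc m)) (v : Fin (suc m)) where

  delete : Graph m
  delete = record
    { adj    = λ i j → adj G (punchIn v i) (punchIn v j)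
    ; sym    = λ i j → adj-sym G (punchIn v i) (punchIn v j)
    ; irrefl = λ i → irrefl G (punchIn v i)
    }

  count-punchIn : ∀ P → count P ≡ ⟦ P v ⟧ + count (P ∘ punchIn v)
  count-punchIn P = sum-punchIn v (⟦_⟧ ∘ P)

  count-adj-v : count (adj G v) ≡ sum (λ j → ⟦ adj G (punchIn v j) v ⟧)
  count-adj-v = begin
    count (adj G v)
      ≡⟨ count-punchIn (adj G v) ⟩
    ⟦ adj G v v ⟧ + count (adj G v ∘ punchIn v)
      ≡⟨ cong₂ _+_ (cong ⟦_⟧ (irrefl G v)) (sum-cong λ j → cong ⟦_⟧ (adj-sym G v (punchIn v j))) ⟩
    sum (λ j → ⟦ adj G (punchIn v j) v ⟧) ∎
    where open ≡-Reasoning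

  -- The row and the column of `v` in the adjacency matrix both disappear, and they share only a
  -- zero diagonal entry.
  degree-sum-delete : degree-sum G ≡ degree-sum delete + 2 * count (adj G v)
  degree-sum-delete = begin
    degree-sum G
      ≡⟨ sum-punchIn v _ ⟩
    count (adj G v) + sum (λ j → count (adj G (punchIn v j)))
      ≡⟨ cong (_+_ (count (adj G v))) (trans (sum-cong λ j → count-punchIn (adj G (punchIn v j))) (sum-+ _ _)) ⟩
    count (adj G v) + (sum (λ j → ⟦ adj G (punchIn v j) v ⟧) + degree-sum delete)
      ≡⟨ cong (λ d → count (adj G v) + (d + degree-sum delete)) (sym count-adj-v) ⟩
    count (adj G v) + (count (adj G v) + degree-sum delete)
      ≡⟨ rearrange (count (adj G v)) (degree-sum delete) ⟩
    degree-sum delete + 2 * count (adj G v) ∎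
    where
    open ≡-Reasoning
    rearrange : ∀ d t → d + (d + t) ≡ t + 2 * d
    rearrange d t = solve (d ∷ t ∷ [])

  -- Codegrees can only drop, and an independent set extended by `false` at `v` keeps its size and
  -- stays independent.
  bounded-delete : ∀ {a} → Bounded a G → Bounded a delete
  bounded-delete {a} bd = record
    { codegree     = λ i j ij → ≤-trans (m≤n+m _ _)
        (subst (_≤ a) (count-punchIn (adj G (punchIn v i) ∩ adj G (punchIn v j))) (codegree _ _ ij))
    ; independence = λ P indep → subst (_≤ a) (extend-count P) (independence (extend P) (extend-independent P indep))
    }
    where
    open Bounded bd
    extend : VSet m → VSet (suc m)
    extend P = insertAt P v false
    extend-count : ∀ P → count (extend P) ≡ count P
    extend-count P = trans (count-punchIn (extend P))
      (cong₂ _+_ (cong ⟦_⟧ (insertAt-lookup P v false)) (sum-cong λ i → cong ⟦_⟧ (insertAt-punchIn P v false i)))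
    extend-true : ∀ P i → extend P i ≡ true → Σ (Fin m) λ i′ → punchIn v i′ ≡ i × P i′ ≡ true
    extend-true P i Pi with v Fin.≟ i
    ... | yes refl = contradiction (trans (sym Pi) (insertAt-lookup P v false)) λ ()
    ... | no v≢i   = punchOut v≢i , Fin.punchIn-punchOut v≢i ,
      trans (sym (insertAt-punchIn P v false (punchOut v≢i))) (trans (cong (extend P) (Fin.punchIn-punchOut v≢i)) Pi)
    extend-independent : ∀ P → IsIndependent delete P → IsIndependent G (extend P)
    extend-independent P indep i j Pi Pj with extend-true P i Pi | extend-true P j Pj
    ... | i′ , refl , Pi′ | j′ , refl , Pj′ = indep i′ j′ Pi′ Pj′

module EdgeBound (a n₀ B : ℕ) (B-big : ∀ k → k ≤ 101 → 1000 ^ k ≤ B) (n₀-large : 40 * 250 ≤ n₀)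
  (a-small : 40 * (1000 * a * B) ≤ n₀) where

  -- In terms of edges, the surplus over 499 m² / 4000 is at most n₀² / 4000 + a n₀. With `n₀` fixed
  -- as the original order, the case m = n₀ reads n₀² / 8 + a n₀.
  Bound : ∀ {m} → Graph m → Set
  Bound {m} G = 2000 * degree-sum G ≤ 499 * (m * m) + n₀ * n₀ + 4000 * (a * n₀)

  -- Even the trivial degree sum m² suffices: 2000 m² exceeds 499 m² by 1501 m², and 1600 m² ≤ n₀².
  bound-small : ∀ {m} (G : Graph m) → 40 * m ≤ n₀ → Bound G
  bound-small {m} G m-small = arith m n₀ (a * n₀) (degree-sum G)
    (≤-trans (sum-mono λ x → count-≤ (adj G x)) (≤-reflexive (sum-const m))) (*-mono-≤ m-small m-small)
    where
    arith : ∀ m n₀ an t → t ≤ m * m → (40 * m) * (40 * m) ≤ n₀ * n₀ →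
      2000 * t ≤ 499 * (m * m) + n₀ * n₀ + 4000 * an
    arith m n₀ an t h₁ h₂ = certify 1 (99 * (m * m) + 4000 * an) (2000 ⊙ h₁ ⊕ h₂) (solve (m ∷ n₀ ∷ an ∷ t ∷ []))

  -- The 40 in `a-small` cancels against `n₀ < 40 * m`, so `a` is still small relative to the
  -- remaining `m` vertices.
  bound-min-degree : ∀ {m} (G : Graph m) → Bounded a G → m ≤ n₀ → n₀ < 40 * m →
    (∀ x → 249 * m ≤ 1000 * count (adj G x)) → Bound G
  bound-min-degree {m} G bd m≤n₀ m-large min-degree = arith m n₀ a (degree-sum G)
    (degree-sum-bound G bd (m>0 m m-large) min-degree B B-big
      (*-cancelˡ-≤ 40 (≤-trans a-small (<⇒≤ m-large))))
    (*-mono-≤ m≤n₀ m≤n₀) (*-monoʳ-≤ a m≤n₀)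
    where
    m>0 : ∀ m → n₀ < 40 * m → 0 < m
    m>0 (suc _) _ = s≤s z≤n
    arith : ∀ m n₀ a t → 4 * t ≤ m * m + 8 * (a * m) → m * m ≤ n₀ * n₀ → a * m ≤ a * n₀ →
      2000 * t ≤ 499 * (m * m) + n₀ * n₀ + 4000 * (a * n₀)
    arith m n₀ a t h₁ h₂ h₃ = certify 1 0 (500 ⊙ h₁ ⊕ h₂ ⊕ 4000 ⊙ h₃) (solve (m ∷ n₀ ∷ a ∷ t ∷ []))

  -- Write m₁ for `suc m`. Restoring `v` raises the left side by 4000 times its degree, at most 996
  -- m₁, and the right side by 998 m₁ - 499, which is larger once m₁ ≥ 250.
  bound-delete : ∀ {m} (G : Graph (suc m)) v → n₀ < 40 * suc m → 1000 * count (adj G v) < 249 * suc m →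
    Bound (Delete.delete G v) → Bound G
  bound-delete {m} G v m-large low h = arith m (suc m) n₀ (a * n₀) (degree-sum G) (degree-sum (Delete.delete G v))
    (count (adj G v)) (+-comm m 1) (*-cancelˡ-≤ 40 (≤-trans n₀-large (<⇒≤ m-large))) (<⇒≤ low)
    (Delete.degree-sum-delete G v) h
    where
    arith : ∀ m m₁ n₀ an t t′ d → m + 1 ≡ m₁ → 250 ≤ m₁ → 1000 * d ≤ 249 * m₁ → t ≡ t′ + 2 * d →
      2000 * t′ ≤ 499 * (m * m) + n₀ * n₀ + 4000 * an →
      2000 * t ≤ 499 * (m₁ * m₁) + n₀ * n₀ + 4000 * an
    arith m m₁ n₀ an t t′ d refl h₁ h₂ refl h₃ =
      certify 1 1 (2 ⊙ h₁ ⊕ 4 ⊙ h₂ ⊕ h₃) (solve (m ∷ n₀ ∷ an ∷ t′ ∷ d ∷ []))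

  mutual
    bound : ∀ m → m ≤ n₀ → (G : Graph m) → Bounded a G → Bound G
    bound zero    _    G bd = bound-small G z≤n
    bound (suc m) m≤n₀ G bd = decide m m≤n₀ G bd (40 * suc m ≤? n₀) (Fin.any? λ x → 1000 * count (adj G x) <? 249 * suc m)

    decide : ∀ m → suc m ≤ n₀ → (G : Graph (suc m)) → Bounded a G → Dec (40 * suc m ≤ n₀) →
      Dec (Σ (Fin (suc m)) λ x → 1000 * count (adj G x) < 249 * suc m) → Bound G
    decide m m≤n₀ G bd (yes small) _               = bound-small G small
    decide m m≤n₀ G bd (no large)  (no none)       = bound-min-degree G bd m≤n₀ (≰⇒> large) λ x → ≮⇒≥ λ low → none (x , low)
    decide m m≤n₀ G bd (no large)  (yes (v , low)) = bound-delete G v (≰⇒> large) low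
      (bound m (<⇒≤ m≤n₀) (Delete.delete G v) (Delete.bounded-delete G v bd))

-- Translation of the statement

sum-empty : (f : Fin 0 → ℕ) → sum f ≡ 0
sum-empty f = trans (sum-cong λ ()) (sum-const {0} 0)

sum-allFin : ∀ {n} (f : Fin n → ℕ) → ℕ.sum (List.map f (List.allFin n)) ≡ sum f
sum-allFin f = trans (cong ℕ.sum (List.map-tabulate id f)) (sum-tabulate f)
  where
  sum-tabulate : ∀ {n} (f : Fin n → ℕ) → ℕ.sum (List.tabulate f) ≡ sum f
  sum-tabulate {zero}  f = sym (sum-empty f)
  sum-tabulate {suc n} f = trans (cong (_+_ (f zero)) (sum-tabulate (f ∘ suc))) (sym (sum-punchIn zero f))

-- `upper` is the strict upper triangle of the adjacency matrix; adding its transpose restores all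
-- off-diagonal entries, and the diagonal is zero.
2*edgeCount : ∀ {n} (G : Graph n) → 2 * edgeCount G ≡ degree-sum G
2*edgeCount {n} G = begin
  2 * edgeCount G
    ≡⟨ cong (2 *_) (trans (sum-allFin {n} _) (sum-cong λ i → sum-allFin {n} (upper i))) ⟩
  2 * sum (λ i → sum (upper i))
    ≡⟨ cong (_+_ (sum (λ i → sum (upper i)))) (trans (+-identityʳ _) (sum-comm upper)) ⟩
  sum (λ i → sum (upper i)) + sum (λ i → sum (λ j → upper j i))
    ≡⟨ trans (sum-cong λ i → sum-+ _ _) (sum-+ _ _) ⟨
  sum (λ i → sum (λ j → upper i j + upper j i))
    ≡⟨ sum-cong (λ i → sum-cong λ j → symmetrize i j) ⟩
  degree-sum G ∎
  where
  open ≡-Reasoning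
  upper : Fin n → Fin n → ℕ
  upper i j = if does (i Fin.<? j) then (if adj G i j then 1 else 0) else 0
  indicator : ∀ b → (if b then 1 else 0) ≡ ⟦ b ⟧
  indicator true  = refl
  indicator false = refl
  pointwise : ∀ i j (i<j? : Dec (i Fin.< j)) (j<i? : Dec (j Fin.< i)) →
    (if does i<j? then (if adj G i j then 1 else 0) else 0) + (if does j<i? then (if adj G j i then 1 else 0) else 0)
      ≡ ⟦ adj G i j ⟧
  pointwise i j (yes i<j) (yes j<i) = contradiction j<i (Fin.<-asym i<j)
  pointwise i j (yes i<j) (no  _)   = trans (+-identityʳ _) (indicator (adj G i j))
  pointwise i j (no  _)   (yes j<i) = trans (indicator (adj G j i)) (cong ⟦_⟧ (adj-sym G j i))
  pointwise i j (no  i≮j) (no  j≮i) with Fin.<-cmp i j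
  ... | tri< i<j _ _  = contradiction i<j i≮j
  ... | tri≈ _ refl _ = sym (cong ⟦_⟧ (irrefl G i))
  ... | tri> _ _ j<i  = contradiction j<i j≮i
  symmetrize : ∀ i j → upper i j + upper j i ≡ ⟦ adj G i j ⟧
  symmetrize i j = pointwise i j (i Fin.<? j) (j Fin.<? i)

-- An edge `u v` with an edge `i j` in its common neighbourhood: decidable by search over vertices,
-- and the form in which K₄-freeness bounds codegrees. Distinctness follows from irreflexivity.
Tetrahedron : ∀ {n} → Graph n → Set
Tetrahedron {n} G = Σ (Fin n) λ u → Σ (Fin n) λ v → adj G u v ≡ true ×
  Σ (Fin n) λ i → (adj G u i ≡ true × adj G v i ≡ true) ×
  Σ (Fin n) λ j → (adj G u j ≡ true × adj G v j ≡ true) × adj G i j ≡ true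

tetrahedron? : ∀ {n} (G : Graph n) → Dec (Tetrahedron G)
tetrahedron? G =
  Fin.any? λ u → Fin.any? λ v → (adj G u v Bool.≟ true) ×-dec
  Fin.any? λ i → ((adj G u i Bool.≟ true) ×-dec (adj G v i Bool.≟ true)) ×-dec
  Fin.any? λ j → ((adj G u j Bool.≟ true) ×-dec (adj G v j Bool.≟ true)) ×-dec (adj G i j Bool.≟ true)

tetrahedron⇒HasK4 : ∀ {n} (G : Graph n) → Tetrahedron G → HasK4 G
tetrahedron⇒HasK4 {n} G (u , v , uv , i , (ui , vi) , j , (uj , vj) , ij) = f , injective , adjacent
  where
  f : Fin 4 → Fin n
  f = Vec.lookup (u Vec.∷ v Vec.∷ i Vec.∷ j Vec.∷ Vec.[])
  flip : ∀ {x y} → adj G x y ≡ true → adj G y x ≡ true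
  flip = trans (adj-sym G _ _)
  adjacent : ∀ a b → ¬ a ≡ b → adj G (f a) (f b) ≡ true
  adjacent zero zero a≢b = contradiction refl a≢b
  adjacent zero (suc zero) _ = uv
  adjacent zero (suc (suc zero)) _ = ui
  adjacent zero (suc (suc (suc zero))) _ = uj
  adjacent (suc zero) zero _ = flip uv
  adjacent (suc zero) (suc zero) a≢b = contradiction refl a≢b
  adjacent (suc zero) (suc (suc zero)) _ = vi
  adjacent (suc zero) (suc (suc (suc zero))) _ = vj
  adjacent (suc (suc zero)) zero _ = flip ui
  adjacent (suc (suc zero)) (suc zero) _ = flip vi
  adjacent (suc (suc zero)) (suc (suc zero)) a≢b = contradiction refl a≢b
  adjacent (suc (suc zero)) (suc (suc (suc zero))) _ = ij
  adjacent (suc (suc (suc zero))) zero _ = flip uj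
  adjacent (suc (suc (suc zero))) (suc zero) _ = flip vj
  adjacent (suc (suc (suc zero))) (suc (suc zero)) _ = flip ij
  adjacent (suc (suc (suc zero))) (suc (suc (suc zero))) a≢b = contradiction refl a≢b
  injective : ∀ {a b} → f a ≡ f b → a ≡ b
  injective {a} {b} fa≡fb with a Fin.≟ b
  ... | yes a≡b = a≡b
  ... | no  a≢b = contradiction
    (trans (sym (adjacent a b a≢b)) (trans (cong (adj G (f a)) (sym fa≡fb)) (irrefl G (f a)))) λ ()

∣tabulate∣ : ∀ {n} (P : VSet n) → ∣ Vec.tabulate P ∣ ≡ count P
∣tabulate∣ {zero}  P = sym (sum-empty _)
∣tabulate∣ {suc n} P = trans (head (P zero) (Vec.tabulate (P ∘ suc)))
  (trans (cong (_+_ (⟦ P zero ⟧)) (∣tabulate∣ (P ∘ suc))) (sym (sum-punchIn zero _)))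
  where
  head : ∀ b (S : Subset n) → ∣ b Vec.∷ S ∣ ≡ ⟦ b ⟧ + ∣ S ∣
  head true  S = refl
  head false S = refl

tabulate-independent : ∀ {n} (G : Graph n) P → IsIndependent G P → Independent G (Vec.tabulate P)
tabulate-independent G P indep i j i∈S j∈S = indep i j (member i i∈S) (member j j∈S)
  where
  member : ∀ i → i ∈ Vec.tabulate P → P i ≡ true
  member i i∈S = trans (sym (Vec.lookup∘tabulate P i)) (Vec.[]=⇒lookup i∈S)

bounded : ∀ {n a} (G : Graph n) → ¬ Tetrahedron G → (∀ S → Independent G S → ∣ S ∣ ≤ a) → Bounded a G
bounded {a = a} G K4-free indep-small = record
  { codegree     = λ u v uv → independence (adj G u ∩ adj G v) λ i j uvi uvj →
      Bool.¬-not λ ij → K4-free (u , v , uv , i , ∧-true uvi , j , ∧-true uvj , ij)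
  ; independence = independence
  }
  where
  independence : ∀ P → IsIndependent G P → count P ≤ a
  independence P indep = subst (_≤ a) (∣tabulate∣ P) (indep-small _ (tabulate-independent G P indep))

-- For m = n the bound reads 8 e ≤ n² + 8 a n, while `dense` reads n² + 12 a n ≤ 8 e; the gap 4 a n
-- is positive.
too-many-edges : ∀ n a B → (∀ k → k ≤ 101 → 1000 ^ k ≤ B) → 0 < a → 40 * (1000 * a * B) ≤ n →
  (G : Graph n) → Bounded a G → ¬ n * n + 12 * (a * n) ≤ 8 * edgeCount G
too-many-edges n a B B-big a>0 a-small G bd dense = arith n a (edgeCount G) (degree-sum G) a>0 n>0
    (2*edgeCount G) (EdgeBound.bound a n B B-big n-large a-small n ≤-refl G bd) dense
  where
  large : ∀ a B → 0 < a → 0 < B → 250 ≤ 1000 * a * B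
  large (suc a) (suc B) _ _ = ≤-trans (≤ᵇ⇒≤ 250 1000 _) (≤-trans (m≤m*n 1000 (suc a)) (m≤m*n (1000 * suc a) (suc B)))
  n-large : 40 * 250 ≤ n
  n-large = ≤-trans (*-monoʳ-≤ 40 {250} {1000 * a * B} (large a B a>0 (B-big 0 z≤n))) a-small
  n>0 : 0 < n
  n>0 = ≤-trans (s≤s z≤n) n-large
  arith : ∀ n a e t → 0 < a → 0 < n → 2 * e ≡ t → 2000 * t ≤ 499 * (n * n) + n * n + 4000 * (a * n) →
    ¬ n * n + 12 * (a * n) ≤ 8 * e
  arith n a e t a>0 n>0 refl h₁ h₂ = <⇒≱ {0} {a * n} (*-mono-< a>0 n>0)
    (certify 2000 0 (h₁ ⊕ 500 ⊙ h₂) (solve (n ∷ a ∷ e ∷ [])))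

-- From rational to integer thresholds

BigIndependent : ∀ {n} → Graph n → ℚ → Set
BigIndependent {n} G α = Σ (Subset n) λ S → Independent G S × α ℚ.< ℕ→ℚ ∣ S ∣

-- The conclusion is a constructive disjunction; deciding both alternatives makes room for an
-- argument by contradiction.
bigIndependent? : ∀ {n} (G : Graph n) α → Dec (BigIndependent G α)
bigIndependent? G α = anySubset? λ S →
  (Fin.all? λ i → Fin.all? λ j → (i ∈? S) →-dec ((j ∈? S) →-dec (adj G i j Bool.≟ false)))
  ×-dec (α ℚ.<? ℕ→ℚ ∣ S ∣)

-- toℚᵘ-fromℚᵘ relates both the scaled naturals of the statement and γ₀ to unreduced fractions, on which
-- the order is an inequality between integers.
toℚᵘ-ℕ→ℚ : ∀ k → toℚᵘ (ℕ→ℚ k) ≃ mkℚᵘ (+ k) 0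
toℚᵘ-ℕ→ℚ k = ℚ.toℚᵘ-fromℚᵘ (mkℚᵘ (+ k) 0)

ℕ→ℚ≤⇒ : ∀ k z d .(c : Coprime ℤ.∣ z ∣ (suc d)) → ℕ→ℚ k ℚ.≤ mkℚ z d c → + (k * suc d) ℤ.≤ z
ℕ→ℚ≤⇒ k z d c h = subst₂ ℤ._≤_ (sym (ℤ.pos-* k (suc d))) (ℤ.*-identityʳ z)
  (ℚᵘ.drop-*≤* (ℚᵘ.≤-respˡ-≃ (toℚᵘ-ℕ→ℚ k) (ℚ.toℚᵘ-mono-≤ h)))

α<⇒ : ∀ p d .(c : Coprime p (suc d)) D n → mkℚ (+ p) d c ℚ.< fromℚᵘ (mkℚᵘ (+ 1) D) ℚ.* ℕ→ℚ n → p * suc D ≤ n * suc d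
α<⇒ p d c D n h = ℤ.drop‿+≤+ (subst₂ ℤ._≤_ lhs rhs (ℤ.<⇒≤ (ℚᵘ.drop-*<* (ℚᵘ.<-respʳ-≃ γ₀n (ℚ.toℚᵘ-mono-< h)))))
  where
  γ₀n : toℚᵘ (fromℚᵘ (mkℚᵘ (+ 1) D) ℚ.* ℕ→ℚ n) ≃ mkℚᵘ (+ 1) D ℚᵘ.* mkℚᵘ (+ n) 0
  γ₀n = ℚᵘ.≃-trans (ℚ.toℚᵘ-homo-* (fromℚᵘ (mkℚᵘ (+ 1) D)) (ℕ→ℚ n))
    (ℚᵘ.*-cong (ℚ.toℚᵘ-fromℚᵘ (mkℚᵘ (+ 1) D)) (toℚᵘ-ℕ→ℚ n))
  lhs : + p ℤ.* + (suc D * 1) ≡ + (p * suc D)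
  lhs = trans (sym (ℤ.pos-* p (suc D * 1))) (cong (λ x → + (p * x)) (*-identityʳ (suc D)))
  rhs : (+ 1 ℤ.* + n) ℤ.* + suc d ≡ + (n * suc d)
  rhs = trans (cong (ℤ._* + suc d) (ℤ.*-identityˡ (+ n))) (sym (ℤ.pos-* n (suc d)))

edges⇒ : ∀ p d .(c : Coprime p (suc d)) n e → (+ (n * n) ℚ./ 8) ℚ.+ (+ 3 ℚ./ 2) ℚ.* mkℚ (+ p) d c ℚ.* ℕ→ℚ n ℚ.≤ ℕ→ℚ e →
  suc d * (n * n) + 12 * (p * n) ≤ suc d * (8 * e)
edges⇒ p d c n e h = arith (suc d) p n e (ℤ.drop‿+≤+ (subst₂ ℤ._≤_ lhs rhs
    (ℚᵘ.drop-*≤* (ℚᵘ.≤-respˡ-≃ bound (ℚᵘ.≤-respʳ-≃ (toℚᵘ-ℕ→ℚ e) (ℚ.toℚᵘ-mono-≤ h))))))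
  where
  α : ℚ
  α = mkℚ (+ p) d c
  bound : toℚᵘ ((+ (n * n) ℚ./ 8) ℚ.+ (+ 3 ℚ./ 2) ℚ.* α ℚ.* ℕ→ℚ n) ≃
    mkℚᵘ (+ (n * n)) 7 ℚᵘ.+ mkℚᵘ (+ 3) 1 ℚᵘ.* mkℚᵘ (+ p) d ℚᵘ.* mkℚᵘ (+ n) 0
  bound = ℚᵘ.≃-trans (ℚ.toℚᵘ-homo-+ (+ (n * n) ℚ./ 8) ((+ 3 ℚ./ 2) ℚ.* α ℚ.* ℕ→ℚ n))
    (ℚᵘ.+-cong (ℚ.toℚᵘ-fromℚᵘ (mkℚᵘ (+ (n * n)) 7))
      (ℚᵘ.≃-trans (ℚ.toℚᵘ-homo-* ((+ 3 ℚ./ 2) ℚ.* α) (ℕ→ℚ n))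
        (ℚᵘ.*-cong (ℚ.toℚᵘ-homo-* (+ 3 ℚ./ 2) α) (toℚᵘ-ℕ→ℚ n))))
  -- The denominator of the unreduced product of 3/2, `α` and `n`.
  q : ℕ
  q = 2 * suc d * 1
  lhs : (+ (n * n) ℤ.* + q ℤ.+ (+ 3 ℤ.* + p) ℤ.* + n ℤ.* + 8) ℤ.* + 1 ≡ + ((n * n) * q + 3 * p * n * 8)
  lhs = begin
    (+ (n * n) ℤ.* + q ℤ.+ (+ 3 ℤ.* + p) ℤ.* + n ℤ.* + 8) ℤ.* + 1
      ≡⟨ ℤ.*-identityʳ _ ⟩
    + (n * n) ℤ.* + q ℤ.+ (+ 3 ℤ.* + p) ℤ.* + n ℤ.* + 8
      ≡⟨ cong₂ ℤ._+_ (sym (ℤ.pos-* (n * n) q)) (cong (λ x → x ℤ.* + n ℤ.* + 8) (sym (ℤ.pos-* 3 p))) ⟩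
    + (n * n * q) ℤ.+ + (3 * p) ℤ.* + n ℤ.* + 8
      ≡⟨ cong (λ x → + (n * n * q) ℤ.+ x ℤ.* + 8) (sym (ℤ.pos-* (3 * p) n)) ⟩
    + (n * n * q) ℤ.+ + (3 * p * n) ℤ.* + 8
      ≡⟨ cong (ℤ._+_ (+ (n * n * q))) (sym (ℤ.pos-* (3 * p * n) 8)) ⟩
    + (n * n * q) ℤ.+ + (3 * p * n * 8)
      ≡⟨ ℤ.pos-+ (n * n * q) (3 * p * n * 8) ⟨
    + (n * n * q + 3 * p * n * 8) ∎
    where open ≡-Reasoning
  rhs : + e ℤ.* + (8 * q) ≡ + (e * (8 * q))
  rhs = sym (ℤ.pos-* e (8 * q))
  arith : ∀ q p n e → n * n * (2 * q * 1) + 3 * p * n * 8 ≤ e * (8 * (2 * q * 1)) →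
    q * (n * n) + 12 * (p * n) ≤ q * (8 * e)
  arith q p n e h = certify 2 0 h (solve (q ∷ p ∷ n ∷ e ∷ []))

module Threshold (B : ℕ) (B-big : ∀ k → k ≤ 101 → 1000 ^ k ≤ B) where

  -- `mkℚᵘ` takes the predecessor of the denominator, so the value is 1 / (40000 B + 1). The factor
  -- 40 allows for deletions down to n / 40 vertices, and 1000 B for the shrinking of `U`.
  γ₀ : ℚ
  γ₀ = fromℚᵘ (mkℚᵘ (+ 1) (40 * (1000 * B)))

  γ₀>0 : 0ℚ ℚ.< γ₀
  γ₀>0 = ℚ.toℚᵘ-cancel-< (ℚᵘ.<-respʳ-≃ (ℚᵘ.≃-sym (ℚ.toℚᵘ-fromℚᵘ (mkℚᵘ (+ 1) (40 * (1000 * B))))) (*<* (ℤ.+<+ (s≤s z≤n))))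

  -- For nonnegative `α` the integer `a` is its floor: it bounds independent sets just as well, and
  -- putting it for `α` only weakens the edge hypothesis.
  many-edges⇒ : ∀ n α → α ℚ.< γ₀ ℚ.* ℕ→ℚ (suc n) → (G : Graph (suc n)) →
    (+ (suc n * suc n) ℚ./ 8) ℚ.+ (+ 3 ℚ./ 2) ℚ.* α ℚ.* ℕ→ℚ (suc n) ℚ.≤ ℕ→ℚ (edgeCount G) →
    ¬ Tetrahedron G → ¬ ¬ BigIndependent G α
  many-edges⇒ n (mkℚ z d c) α-small G dense K4-free indep-small = by-sign z c α-small dense
      (λ S indep → ℕ→ℚ≤⇒ ∣ S ∣ z d c (ℚ.≮⇒≥ λ big → indep-small (S , indep , big)))
    where
    singleton-independent : Independent G ⁅ zero ⁆
    singleton-independent i j i∈ j∈ = trans (cong₂ (adj G) (x∈⁅y⁆⇒x≡y zero i∈) (x∈⁅y⁆⇒x≡y zero j∈)) (irrefl G zero)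
    by-sign : ∀ z .(c : Coprime ℤ.∣ z ∣ (suc d)) → mkℚ z d c ℚ.< γ₀ ℚ.* ℕ→ℚ (suc n) →
      (+ (suc n * suc n) ℚ./ 8) ℚ.+ (+ 3 ℚ./ 2) ℚ.* mkℚ z d c ℚ.* ℕ→ℚ (suc n) ℚ.≤ ℕ→ℚ (edgeCount G) →
      ¬ (∀ S → Independent G S → + (∣ S ∣ * suc d) ℤ.≤ z)
    -- A single vertex is an independent set larger than a negative `α`.
    by-sign -[1+ _ ] c α-small dense size-≤ = contradiction (size-≤ ⁅ zero ⁆ singleton-independent) λ ()
    by-sign (+ p)    c α-small dense size-≤ =
      too-many-edges (suc n) a B B-big
        -- The singleton also shows that the floor is at least 1.
        (≤-trans (≤-reflexive (sym (∣⁅x⁆∣≡1 {suc n} zero))) (size-≤a ⁅ zero ⁆ singleton-independent))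
        (*-cancelʳ-≤ (40 * (1000 * a * B)) (suc n) q
          (scale a p q B (suc n) a*q≤p (α<⇒ p d c (40 * (1000 * B)) (suc n) α-small)))
        G (bounded G K4-free size-≤a)
        (*-cancelˡ-≤ q (edges-scale a p q (suc n) (edgeCount G) a*q≤p (edges⇒ p d c (suc n) (edgeCount G) dense)))
      where
      q a : ℕ
      q = suc d
      a = p / q
      a*q≤p : a * q ≤ p
      a*q≤p = m/n*n≤m p q
      size-≤a : ∀ S → Independent G S → ∣ S ∣ ≤ a
      size-≤a S indep = subst (_≤ a) (m*n/n≡m ∣ S ∣ q) (/-mono-≤ (ℤ.drop‿+≤+ (size-≤ S indep)) ≤-refl)
      scale : ∀ a p q B n → a * q ≤ p → p * suc (40 * (1000 * B)) ≤ n * q → 40 * (1000 * a * B) * q ≤ n * q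
      scale a p q B n h₁ h₂ = certify 1 p ((40 * (1000 * B)) ⊙ h₁ ⊕ h₂) (solve (a ∷ p ∷ q ∷ B ∷ n ∷ []))
      edges-scale : ∀ a p q n e → a * q ≤ p → q * (n * n) + 12 * (p * n) ≤ q * (8 * e) →
        q * (n * n + 12 * (a * n)) ≤ q * (8 * e)
      edges-scale a p q n e h₁ h₂ = certify 1 0 ((12 * n) ⊙ h₁ ⊕ h₂) (solve (a ∷ p ∷ q ∷ n ∷ e ∷ []))

-- Each growth step shrinks U by a factor of at most 1000, and C can grow at most 100 times.
opaque
  constant : ℕ
  constant = 1000 ^ 101

  constant-large : ∀ k → k ≤ 101 → 1000 ^ k ≤ constant
  constant-large k = ^-monoʳ-≤ 1000

theorem1p6 : Σ ℚ λ γ₀ → (0ℚ ℚ.< γ₀) ×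
    ((n : ℕ) → NonZero n → (α : ℚ) → α ℚ.< γ₀ ℚ.* ℕ→ℚ n → (G : Graph n) →
    (+ (n * n) ℚ./ 8) ℚ.+ (+ 3 ℚ./ 2) ℚ.* α ℚ.* ℕ→ℚ n ℚ.≤ ℕ→ℚ (edgeCount G) →
    HasK4 G ⊎ Σ (Subset n) λ S → Independent G S × α ℚ.< ℕ→ℚ ∣ S ∣)
theorem1p6 = γ₀ , γ₀>0 , λ where
    (suc n) _ α α-small G dense → decide n α α-small G dense (tetrahedron? G) (bigIndependent? G α)
  where
  open Threshold constant constant-large
  decide : ∀ n α → α ℚ.< γ₀ ℚ.* ℕ→ℚ (suc n) → (G : Graph (suc n)) →
    (+ (suc n * suc n) ℚ./ 8) ℚ.+ (+ 3 ℚ./ 2) ℚ.* α ℚ.* ℕ→ℚ (suc n) ℚ.≤ ℕ→ℚ (edgeCount G) →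
    Dec (Tetrahedron G) → Dec (BigIndependent G α) → HasK4 G ⊎ BigIndependent G α
  decide n α α-small G dense (yes K4) _         = inj₁ (tetrahedron⇒HasK4 G K4)
  decide n α α-small G dense (no _)   (yes big) = inj₂ big
  decide n α α-small G dense (no ¬K4) (no ¬big) = contradiction ¬big (many-edges⇒ n α α-small G dense ¬K4)
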